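{- Let $\Lambda=\mathsf{iA}\oplus\Gamma$ be an $\mathsf{iA}$-logic. Then $\Lambda$ is embedded by $t$ in every $\mathsf{S4K}$-logic $\Theta$ with $(\mathsf{S4}\otimes\mathsf K)\oplus t(\Gamma)\subseteq\Theta\subseteq(\mathsf{Grz_i}\otimes\mathsf K)\oplus t(\Gamma)\oplus\mathsf{BHL}$; that is, for all $\varphi\in\mathcal L_{\rightsquigarrow}$, $\varphi\in\Lambda$ iff $t(\varphi)\in\Theta$.
   Context: $\mathcal L_{\rightsquigarrow}$: $\varphi::=p\mid\top\mid\bot\mid\varphi\wedge\varphi\mid\varphi\vee\varphi\mid\varphi\to\varphi\mid\varphi\rightsquigarrow\varphi$. An $\mathsf{iA}$-logic is a set of $\mathcal L_{\rightsquigarrow}$-formulas containing all intuitionistic propositional theorems and all instances of $((\varphi\rightsquigarrow\psi)\wedge(\varphi\rightsquigarrow\chi))\to(\varphi\rightsquigarrow(\psi\wedge\chi))$, $((\varphi\rightsquigarrow\chi)\wedge(\psi\rightsquigarrow\chi))\to((\varphi\vee\psi)\rightsquigarrow\chi)$, $((\varphi\rightsquigarrow\psi)\wedge(\psi\rightsquigarrow\chi))\to(\varphi\rightsquigarrow\chi)$, closed under modus ponens, the rule from $\varphi\to\psi$ infer $\varphi\rightsquigarrow\psi$, and uniform substitution; $\mathsf{iA}$ is the smallest one and $\mathsf{iA}\oplus\Gamma$ the smallest containing $\Gamma$. $\mathcal L_{i,m}$: classical bimodal formulas with boxes $\Box_i,\Box_m$. An $\mathsf{S4K}$-logic is a set of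 $\mathcal L_{i,m}$-formulas containing all classical tautologies, the $\mathsf K$ axioms for both boxes, $\Box_ip\to p$ and $\Box_ip\to\Box_i\Box_ip$, closed under modus ponens, necessitation for both boxes, and uniform substitution. $\mathsf{S4}\otimes\mathsf K$ is the smallest $\mathsf{S4K}$-logic, $\Theta\oplus\Delta$ the smallest $\mathsf{S4K}$-logic containing $\Theta\cup\Delta$, $\mathsf{Grz_i}\otimes\mathsf K=(\mathsf{S4}\otimes\mathsf K)\oplus\Box_i(\Box_i(p\to\Box_ip)\to p)\to p$, and $\mathsf{BHL}$ is $\Box_mp\to\Box_i\Box_mp$. Translation $t$: $t(p)=\Box_ip$, $t(\top)=\top$, $t(\bot)=\bot$, $t(\varphi\wedge\psi)=\Box_i(t\varphi\wedge t\psi)$, $t(\varphi\vee\psi)=\Box_i(t\varphi\vee t\psi)$, $t(\varphi\to\psi)=\Box_i(t\varphi\to t\psi)$, $t(\varphi\rightsquigarrow\psi)=\Box_i\Box_m(t\varphi\to t\psi)$; $t(\Gamma)=\{t(\gamma):\gamma\in\Gamma\}$. -}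

module Defs where

open import Data.Nat using (ℕ)
open import Data.Bool using (Bool; true; false; _∧_; _∨_; not)
open import Data.Product using (Σ; _×_)
open import Data.Sum using (_⊎_)
open import Relation.Binary.PropositionalEquality using (_≡_)

infixr 6 _∧ᵢ_
infixr 5 _∨ᵢ_
infixr 4 _⇒ᵢ_ _⇝_

data IForm : Set where
  var  : ℕ → IForm
  ⊤ᵢ   : IForm
  ⊥ᵢ   : IForm
  _∧ᵢ_ : IForm → IForm → IForm
  _∨ᵢ_ : IForm → IForm → IForm
  _⇒ᵢ_ : IForm → IForm → IForm
  _⇝_  : IForm → IForm → IForm

isub : (ℕ → IForm) → IForm → IForm
isub σ (var n)  = σ n
isub σ ⊤ᵢ       = ⊤ᵢ
isub σ ⊥ᵢ       = ⊥ᵢ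
isub σ (a ∧ᵢ b) = isub σ a ∧ᵢ isub σ b
isub σ (a ∨ᵢ b) = isub σ a ∨ᵢ isub σ b
isub σ (a ⇒ᵢ b) = isub σ a ⇒ᵢ isub σ b
isub σ (a ⇝ b)  = isub σ a ⇝ isub σ b

-- Axiom schemata of a standard Hilbert calculus for intuitionistic
-- propositional logic, instantiated over the whole language L_⇝.
-- Together with modus ponens they generate exactly the intuitionistic
-- propositional theorems of L_⇝.
data IPCAx : IForm → Set where
  ax-K   : ∀ a b → IPCAx (a ⇒ᵢ (b ⇒ᵢ a))
  ax-S   : ∀ a b c → IPCAx ((a ⇒ᵢ (b ⇒ᵢ c)) ⇒ᵢ ((a ⇒ᵢ b) ⇒ᵢ (a ⇒ᵢ c)))
  ax-∧I  : ∀ a b → IPCAx (a ⇒ᵢ (b ⇒ᵢ (a ∧ᵢ b)))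
  ax-∧E₁ : ∀ a b → IPCAx ((a ∧ᵢ b) ⇒ᵢ a)
  ax-∧E₂ : ∀ a b → IPCAx ((a ∧ᵢ b) ⇒ᵢ b)
  ax-∨I₁ : ∀ a b → IPCAx (a ⇒ᵢ (a ∨ᵢ b))
  ax-∨I₂ : ∀ a b → IPCAx (b ⇒ᵢ (a ∨ᵢ b))
  ax-∨E  : ∀ a b c → IPCAx ((a ⇒ᵢ c) ⇒ᵢ ((b ⇒ᵢ c) ⇒ᵢ ((a ∨ᵢ b) ⇒ᵢ c)))
  ax-⊥   : ∀ a → IPCAx (⊥ᵢ ⇒ᵢ a)
  ax-⊤   : IPCAx ⊤ᵢ

data IA⊕ (Γ : IForm → Set) : IForm → Set where
  ipc   : ∀ {φ} → IPCAx φ → IA⊕ Γ φ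
  ax-C  : ∀ a b c → IA⊕ Γ (((a ⇝ b) ∧ᵢ (a ⇝ c)) ⇒ᵢ (a ⇝ (b ∧ᵢ c)))
  ax-D  : ∀ a b c → IA⊕ Γ (((a ⇝ c) ∧ᵢ (b ⇝ c)) ⇒ᵢ ((a ∨ᵢ b) ⇝ c))
  ax-I  : ∀ a b c → IA⊕ Γ (((a ⇝ b) ∧ᵢ (b ⇝ c)) ⇒ᵢ (a ⇝ c))
  i-hyp : ∀ {φ} → Γ φ → IA⊕ Γ φ
  i-mp  : ∀ {φ ψ} → IA⊕ Γ (φ ⇒ᵢ ψ) → IA⊕ Γ φ → IA⊕ Γ ψ
  i-arr : ∀ {φ ψ} → IA⊕ Γ (φ ⇒ᵢ ψ) → IA⊕ Γ (φ ⇝ ψ)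
  i-usub : ∀ {φ} (σ : ℕ → IForm) → IA⊕ Γ φ → IA⊕ Γ (isub σ φ)

infixr 6 _∧ₘ_
infixr 5 _∨ₘ_
infixr 4 _⇒ₘ_

data MForm : Set where
  mvar : ℕ → MForm
  ⊤ₘ   : MForm
  ⊥ₘ   : MForm
  _∧ₘ_ : MForm → MForm → MForm
  _∨ₘ_ : MForm → MForm → MForm
  _⇒ₘ_ : MForm → MForm → MForm
  □ᵢ   : MForm → MForm
  □ₘ   : MForm → MForm

msub : (ℕ → MForm) → MForm → MForm
msub σ (mvar n) = σ n
msub σ ⊤ₘ       = ⊤ₘ
msub σ ⊥ₘ       = ⊥ₘ
msub σ (a ∧ₘ b) = msub σ a ∧ₘ msub σ b
msub σ (a ∨ₘ b) = msub σ a ∨ₘ msub σ b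
msub σ (a ⇒ₘ b) = msub σ a ⇒ₘ msub σ b
msub σ (□ᵢ a)   = □ᵢ (msub σ a)
msub σ (□ₘ a)   = □ₘ (msub σ a)

evalB : (ℕ → Bool) → (MForm → Bool) → MForm → Bool
evalB v b (mvar n) = v n
evalB v b ⊤ₘ       = true
evalB v b ⊥ₘ       = false
evalB v b (x ∧ₘ y) = evalB v b x ∧ evalB v b y
evalB v b (x ∨ₘ y) = evalB v b x ∨ evalB v b y
evalB v b (x ⇒ₘ y) = not (evalB v b x) ∨ evalB v b y
evalB v b (□ᵢ x)   = b (□ᵢ x)
evalB v b (□ₘ x)   = b (□ₘ x)

-- classical tautologies of L_{i,m} (= substitution instances of
-- propositional tautologies)
Taut : MForm → Set
Taut φ = ∀ (v : ℕ → Bool) (b : MForm → Bool) → evalB v b φ ≡ true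

record IsS4KLogic (Θ : MForm → Set) : Set where
  field
    taut  : ∀ {φ} → Taut φ → Θ φ
    Kᵢ    : ∀ a b → Θ (□ᵢ (a ⇒ₘ b) ⇒ₘ (□ᵢ a ⇒ₘ □ᵢ b))
    Kₘ    : ∀ a b → Θ (□ₘ (a ⇒ₘ b) ⇒ₘ (□ₘ a ⇒ₘ □ₘ b))
    Tᵢ    : ∀ a → Θ (□ᵢ a ⇒ₘ a)
    4ᵢ    : ∀ a → Θ (□ᵢ a ⇒ₘ □ᵢ (□ᵢ a))
    mp    : ∀ {φ ψ} → Θ (φ ⇒ₘ ψ) → Θ φ → Θ ψ
    necᵢ  : ∀ {φ} → Θ φ → Θ (□ᵢ φ)
    necₘ  : ∀ {φ} → Θ φ → Θ (□ₘ φ)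
    usub  : ∀ {φ} (σ : ℕ → MForm) → Θ φ → Θ (msub σ φ)

data S4K⊕ (Δ : MForm → Set) : MForm → Set where
  g-taut  : ∀ {φ} → Taut φ → S4K⊕ Δ φ
  g-Kᵢ    : ∀ a b → S4K⊕ Δ (□ᵢ (a ⇒ₘ b) ⇒ₘ (□ᵢ a ⇒ₘ □ᵢ b))
  g-Kₘ    : ∀ a b → S4K⊕ Δ (□ₘ (a ⇒ₘ b) ⇒ₘ (□ₘ a ⇒ₘ □ₘ b))
  g-Tᵢ    : ∀ a → S4K⊕ Δ (□ᵢ a ⇒ₘ a)
  g-4ᵢ    : ∀ a → S4K⊕ Δ (□ᵢ a ⇒ₘ □ᵢ (□ᵢ a))
  g-hyp   : ∀ {φ} → Δ φ → S4K⊕ Δ φ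
  g-mp    : ∀ {φ ψ} → S4K⊕ Δ (φ ⇒ₘ ψ) → S4K⊕ Δ φ → S4K⊕ Δ ψ
  g-necᵢ  : ∀ {φ} → S4K⊕ Δ φ → S4K⊕ Δ (□ᵢ φ)
  g-necₘ  : ∀ {φ} → S4K⊕ Δ φ → S4K⊕ Δ (□ₘ φ)
  g-usub  : ∀ {φ} (σ : ℕ → MForm) → S4K⊕ Δ φ → S4K⊕ Δ (msub σ φ)

p₀ : MForm
p₀ = mvar 0

GrzAx : MForm
GrzAx = □ᵢ (□ᵢ (p₀ ⇒ₘ □ᵢ p₀) ⇒ₘ p₀) ⇒ₘ p₀

BHLAx : MForm
BHLAx = □ₘ p₀ ⇒ₘ □ᵢ (□ₘ p₀)

t : IForm → MForm
t (var n)  = □ᵢ (mvar n)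
t ⊤ᵢ       = ⊤ₘ
t ⊥ᵢ       = ⊥ₘ
t (a ∧ᵢ b) = □ᵢ (t a ∧ₘ t b)
t (a ∨ᵢ b) = □ᵢ (t a ∨ₘ t b)
t (a ⇒ᵢ b) = □ᵢ (t a ⇒ₘ t b)
t (a ⇝ b)  = □ᵢ (□ₘ (t a ⇒ₘ t b))

tImg : (IForm → Set) → MForm → Set
tImg Γ ψ = Σ IForm (λ γ → Γ γ × ψ ≡ t γ)

tImg+Grz+BHL : (IForm → Set) → MForm → Set
tImg+Grz+BHL Γ ψ = tImg Γ ψ ⊎ (ψ ≡ GrzAx ⊎ ψ ≡ BHLAx)

{-# OPTIONS --safe #-}
-- The embedding is faithful because the Lindenbaum algebra H of Λ lives inside
-- a modal algebra validating Grz, BHL and t(Γ): its free Boolean extension B(H).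
-- Elements of B(H) are finite meets of clauses ⋀xs → ⋁ys with xs, ys in H, and
-- the boxes send such a meet to the meet of the ⋀xs ⇒ ⋁ys, respectively of the
-- ⋀xs ⇝ ⋁ys. Both boxes take values in H, which gives BHL, and t φ takes the
-- value of φ under the substitution n ↦ □ᵢ (v n).
module Submission where

open import Defs
open import Data.Bool using (Bool; true; false; not; _∧_; _∨_)
open import Data.Bool.ListAction using (all; any)
open import Data.Bool.Properties using (∨-assoc; ∨-zeroʳ; ∨-identityʳ; ∨-distribˡ-∧; ∨-distribʳ-∧; ∧-identityʳ; ∧-assoc)
open import Data.Empty using (⊥; ⊥-elim)
open import Data.List.Base using (List; []; _∷_; _++_; [_]; map; foldr; cartesianProductWith)
open import Data.List.Membership.Propositional using (_∈_)
open import Data.List.Membership.Propositional.Properties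
  using (∈-++⁺ˡ; ∈-++⁺ʳ; ∈-++⁻; ∈-map⁺; ∈-map⁻; ∈-cartesianProductWith⁺; ∈-cartesianProductWith⁻)
open import Data.List.Relation.Binary.Subset.Propositional using (_⊆_)
open import Data.List.Relation.Unary.Any using (here; there)
open import Data.Maybe.Base using (Maybe; just; nothing; zipWith)
open import Data.Nat using (ℕ)
open import Data.Nat.Properties using (_≟_)
open import Data.Product using (_×_; _,_; proj₁; proj₂; ∃-syntax)
open import Data.Sum using (_⊎_; inj₁; inj₂; [_,_]′)
open import Function using (_∘_; id)
open import Relation.Binary.Definitions using (DecidableEquality)
open import Relation.Binary.PropositionalEquality
  using (_≡_; refl; sym; trans; cong; cong₂; subst)
open import Relation.Nullary using (yes; no; ⌊_⌋)

-- Natural deduction over an arbitrary Hilbert calculus.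

module Deduction {F : Set} (_∧'_ _∨'_ _⇒'_ : F → F → F) (⊤' ⊥' : F) (Thm : F → Set)
  (ax-mp  : ∀ {a b} → Thm (a ⇒' b) → Thm a → Thm b)
  (ax-K   : ∀ a b → Thm (a ⇒' (b ⇒' a)))
  (ax-S   : ∀ a b c → Thm ((a ⇒' (b ⇒' c)) ⇒' ((a ⇒' b) ⇒' (a ⇒' c))))
  (ax-∧I  : ∀ a b → Thm (a ⇒' (b ⇒' (a ∧' b))))
  (ax-∧E₁ : ∀ a b → Thm ((a ∧' b) ⇒' a))
  (ax-∧E₂ : ∀ a b → Thm ((a ∧' b) ⇒' b))
  (ax-∨I₁ : ∀ a b → Thm (a ⇒' (a ∨' b)))
  (ax-∨I₂ : ∀ a b → Thm (b ⇒' (a ∨' b)))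
  (ax-∨E  : ∀ a b c → Thm ((a ⇒' c) ⇒' ((b ⇒' c) ⇒' ((a ∨' b) ⇒' c))))
  (ax-⊥   : ∀ a → Thm (⊥' ⇒' a))
  (ax-⊤   : Thm ⊤')
  where

  infix 3 _⊢_
  -- Modus ponens is the sole rule acting under hypotheses. Necessitation, substitution and the
  -- arrow rule stay inside `Thm`, which is why the deduction theorem `⇒I` holds.
  data _⊢_ (L : List F) : F → Set where
    thm : ∀ {a} → Thm a → L ⊢ a
    hyp : ∀ {a} → a ∈ L → L ⊢ a
    ⇒E  : ∀ {a b} → L ⊢ (a ⇒' b) → L ⊢ a → L ⊢ b

  h₀ : ∀ {a L} → a ∷ L ⊢ a
  h₀ = hyp (here refl)

  h₁ : ∀ {a b L} → b ∷ a ∷ L ⊢ a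
  h₁ = hyp (there (here refl))

  h₂ : ∀ {a b c L} → c ∷ b ∷ a ∷ L ⊢ a
  h₂ = hyp (there (there (here refl)))

  h₃ : ∀ {a b c d L} → d ∷ c ∷ b ∷ a ∷ L ⊢ a
  h₃ = hyp (there (there (there (here refl))))

  theorem : ∀ {a} → [] ⊢ a → Thm a
  theorem (thm p)  = p
  theorem (⇒E p q) = ax-mp (theorem p) (theorem q)

  ⇒I : ∀ {L a b} → a ∷ L ⊢ b → L ⊢ (a ⇒' b)
  ⇒I (thm p)            = ⇒E (thm (ax-K _ _)) (thm p)
  ⇒I {a = a} (hyp (here refl)) = ⇒E (⇒E (thm (ax-S a (a ⇒' a) a)) (thm (ax-K _ _))) (thm (ax-K _ _))
  ⇒I (hyp (there i))    = ⇒E (thm (ax-K _ _)) (hyp i)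
  ⇒I (⇒E p q)           = ⇒E (⇒E (thm (ax-S _ _ _)) (⇒I p)) (⇒I q)

  ⊢-subst : ∀ {L L' a} → (∀ {x} → x ∈ L → L' ⊢ x) → L ⊢ a → L' ⊢ a
  ⊢-subst s (thm p)  = thm p
  ⊢-subst s (hyp i)  = s i
  ⊢-subst s (⇒E p q) = ⇒E (⊢-subst s p) (⊢-subst s q)

  ⊢-weaken : ∀ {L L' a} → L ⊆ L' → L ⊢ a → L' ⊢ a
  ⊢-weaken s = ⊢-subst (hyp ∘ s)

  ⊢-trans : ∀ {L a b} → L ⊢ a → [ a ] ⊢ b → L ⊢ b
  ⊢-trans p = ⊢-subst λ { (here refl) → p }

  ∧I : ∀ {L a b} → L ⊢ a → L ⊢ b → L ⊢ (a ∧' b)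
  ∧I p q = ⇒E (⇒E (thm (ax-∧I _ _)) p) q

  ∧E₁ : ∀ {L a b} → L ⊢ (a ∧' b) → L ⊢ a
  ∧E₁ = ⇒E (thm (ax-∧E₁ _ _))

  ∧E₂ : ∀ {L a b} → L ⊢ (a ∧' b) → L ⊢ b
  ∧E₂ = ⇒E (thm (ax-∧E₂ _ _))

  ∨I₁ : ∀ {L a b} → L ⊢ a → L ⊢ (a ∨' b)
  ∨I₁ = ⇒E (thm (ax-∨I₁ _ _))

  ∨I₂ : ∀ {L a b} → L ⊢ b → L ⊢ (a ∨' b)
  ∨I₂ = ⇒E (thm (ax-∨I₂ _ _))

  ∨E : ∀ {L a b c} → L ⊢ (a ∨' b) → a ∷ L ⊢ c → b ∷ L ⊢ c → L ⊢ c
  ∨E p q r = ⇒E (⇒E (⇒E (thm (ax-∨E _ _ _)) (⇒I q)) (⇒I r)) p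

  ⊥E : ∀ {L a} → L ⊢ ⊥' → L ⊢ a
  ⊥E = ⇒E (thm (ax-⊥ _))

  ⊤I : ∀ {L} → L ⊢ ⊤'
  ⊤I = thm ax-⊤

  ⋀ ⋁ : List F → F
  ⋀ = foldr _∧'_ ⊤'
  ⋁ = foldr _∨'_ ⊥'

  ⋀I : ∀ {L} X → (∀ {x} → x ∈ X → L ⊢ x) → L ⊢ ⋀ X
  ⋀I []      s = ⊤I
  ⋀I (x ∷ X) s = ∧I (s (here refl)) (⋀I X (s ∘ there))

  ⋀E : ∀ {L x X} → x ∈ X → L ⊢ ⋀ X → L ⊢ x
  ⋀E (here refl) p = ∧E₁ p
  ⋀E (there i)   p = ⋀E i (∧E₂ p)

  ⋁I : ∀ {L y Y} → y ∈ Y → L ⊢ y → L ⊢ ⋁ Y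
  ⋁I (here refl) p = ∨I₁ p
  ⋁I (there i)   p = ∨I₂ (⋁I i p)

  ⋁E : ∀ {L z} Y → L ⊢ ⋁ Y → (∀ {y} → y ∈ Y → y ∷ L ⊢ z) → L ⊢ z
  ⋁E []      p s = ⊥E p
  ⋁E (y ∷ Y) p s = ∨E p (s (here refl)) (⋁E Y h₀ (⊢-weaken (λ { (here e) → here e ; (there i) → there (there i) }) ∘ s ∘ there))

-- Soundness of the translation

module Soundness (Θ : MForm → Set) (logic : IsS4KLogic Θ) where
  open IsS4KLogic logic

  module Θ-Tautologies where
    K-taut : ∀ x y → not x ∨ (not y ∨ x) ≡ true
    K-taut false _     = refl
    K-taut true  false = refl
    K-taut true  true  = refl

    S-taut : ∀ x y z → not (not x ∨ (not y ∨ z)) ∨ (not (not x ∨ y) ∨ (not x ∨ z)) ≡ true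
    S-taut false _     _     = refl
    S-taut true  false _     = refl
    S-taut true  true  false = refl
    S-taut true  true  true  = refl

    ∧I-taut : ∀ x y → not x ∨ (not y ∨ (x ∧ y)) ≡ true
    ∧I-taut false _     = refl
    ∧I-taut true  false = refl
    ∧I-taut true  true  = refl

    ∧E₁-taut : ∀ x y → not (x ∧ y) ∨ x ≡ true
    ∧E₁-taut false _ = refl
    ∧E₁-taut true  y = ∨-zeroʳ (not y)

    ∧E₂-taut : ∀ x y → not (x ∧ y) ∨ y ≡ true
    ∧E₂-taut false _     = refl
    ∧E₂-taut true  false = refl
    ∧E₂-taut true  true  = refl

    ∨I₁-taut : ∀ x y → not x ∨ (x ∨ y) ≡ true
    ∨I₁-taut false _ = refl
    ∨I₁-taut true  _ = refl

    ∨I₂-taut : ∀ x y → not y ∨ (x ∨ y) ≡ true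
    ∨I₂-taut x false = refl
    ∨I₂-taut x true  = ∨-zeroʳ x

    ∨E-taut : ∀ x y z → not (not x ∨ z) ∨ (not (not y ∨ z) ∨ (not (x ∨ y) ∨ z)) ≡ true
    ∨E-taut false false _     = refl
    ∨E-taut false true  false = refl
    ∨E-taut false true  true  = refl
    ∨E-taut true  _     false = refl
    ∨E-taut true  false true  = refl
    ∨E-taut true  true  true  = refl

  open Θ-Tautologies

  open Deduction _∧ₘ_ _∨ₘ_ _⇒ₘ_ ⊤ₘ ⊥ₘ Θ mp
    (λ a b → taut λ v β → K-taut (evalB v β a) (evalB v β b))
    (λ a b c → taut λ v β → S-taut (evalB v β a) (evalB v β b) (evalB v β c))
    (λ a b → taut λ v β → ∧I-taut (evalB v β a) (evalB v β b))
    (λ a b → taut λ v β → ∧E₁-taut (evalB v β a) (evalB v β b))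
    (λ a b → taut λ v β → ∧E₂-taut (evalB v β a) (evalB v β b))
    (λ a b → taut λ v β → ∨I₁-taut (evalB v β a) (evalB v β b))
    (λ a b → taut λ v β → ∨I₂-taut (evalB v β a) (evalB v β b))
    (λ a b c → taut λ v β → ∨E-taut (evalB v β a) (evalB v β b) (evalB v β c))
    (λ a → taut λ v β → refl)
    (taut λ v β → refl)

  □ᵢ-elim : ∀ {L a} → L ⊢ □ᵢ a → L ⊢ a
  □ᵢ-elim = ⇒E (thm (Tᵢ _))

  Persistent : List MForm → Set
  Persistent L = ∀ {x} → x ∈ L → [ x ] ⊢ □ᵢ x

  □ᵢ-nec : ∀ L {a} → L ⊢ a → map □ᵢ L ⊢ □ᵢ a
  □ᵢ-nec []      p = thm (necᵢ (theorem p))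
  □ᵢ-nec (x ∷ L) p =
    ⇒E (⇒E (thm (Kᵢ _ _)) (⊢-weaken there (□ᵢ-nec L (⇒I p)))) h₀

  □ₘ-nec : ∀ L {a} → L ⊢ a → map □ₘ L ⊢ □ₘ a
  □ₘ-nec []      p = thm (necₘ (theorem p))
  □ₘ-nec (x ∷ L) p =
    ⇒E (⇒E (thm (Kₘ _ _)) (⊢-weaken there (□ₘ-nec L (⇒I p)))) h₀

  -- Boxing a derivation calls for the boxes of its hypotheses, and a persistent hypothesis supplies
  -- its own.
  □ᵢ-intro : ∀ {L a} → Persistent L → L ⊢ a → L ⊢ □ᵢ a
  □ᵢ-intro {L} π p = ⊢-subst boxed (□ᵢ-nec L p)
    where
    boxed : ∀ {x} → x ∈ map □ᵢ L → L ⊢ x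
    boxed i with ∈-map⁻ □ᵢ i
    ... | x , j , refl = ⊢-trans (hyp j) (π j)

  □ᵢ-persistent : ∀ {a} → [ □ᵢ a ] ⊢ □ᵢ (□ᵢ a)
  □ᵢ-persistent = ⇒E (thm (4ᵢ _)) h₀

  t-persistent : ∀ φ → [ t φ ] ⊢ □ᵢ (t φ)
  t-persistent (var n)  = □ᵢ-persistent
  t-persistent ⊤ᵢ       = thm (necᵢ (theorem ⊤I))
  t-persistent ⊥ᵢ       = ⊥E h₀
  t-persistent (a ∧ᵢ b) = □ᵢ-persistent
  t-persistent (a ∨ᵢ b) = □ᵢ-persistent
  t-persistent (a ⇒ᵢ b) = □ᵢ-persistent
  t-persistent (a ⇝ b)  = □ᵢ-persistent

  map-t-persistent : ∀ L → Persistent (map t L)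
  map-t-persistent L i with ∈-map⁻ t i
  ... | φ , _ , refl = t-persistent φ

  □ᵢ⇒I : ∀ L {a b} → a ∷ map t L ⊢ b → map t L ⊢ □ᵢ (a ⇒ₘ b)
  □ᵢ⇒I L p = □ᵢ-intro (map-t-persistent L) (⇒I p)

  □ᵢ⇒E : ∀ {L a b} → L ⊢ □ᵢ (a ⇒ₘ b) → L ⊢ a → L ⊢ b
  □ᵢ⇒E p = ⇒E (□ᵢ-elim p)

  t-axiom : ∀ {φ} → IPCAx φ → [] ⊢ t φ
  t-axiom (ax-K a b) = □ᵢ⇒I [] (□ᵢ⇒I [ a ] h₁)
  t-axiom (ax-S a b c) =
    □ᵢ⇒I [] (□ᵢ⇒I [ a ⇒ᵢ (b ⇒ᵢ c) ] (□ᵢ⇒I ((a ⇒ᵢ b) ∷ (a ⇒ᵢ (b ⇒ᵢ c)) ∷ [])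
      (□ᵢ⇒E (□ᵢ⇒E h₂ h₀) (□ᵢ⇒E h₁ h₀))))
  t-axiom (ax-∧I a b) = □ᵢ⇒I [] (□ᵢ⇒I [ a ] (□ᵢ-intro (map-t-persistent (b ∷ a ∷ [])) (∧I h₁ h₀)))
  t-axiom (ax-∧E₁ a b) = □ᵢ⇒I [] (∧E₁ (□ᵢ-elim h₀))
  t-axiom (ax-∧E₂ a b) = □ᵢ⇒I [] (∧E₂ (□ᵢ-elim h₀))
  t-axiom (ax-∨I₁ a b) = □ᵢ⇒I [] (□ᵢ-intro (map-t-persistent [ a ]) (∨I₁ h₀))
  t-axiom (ax-∨I₂ a b) = □ᵢ⇒I [] (□ᵢ-intro (map-t-persistent [ b ]) (∨I₂ h₀))
  t-axiom (ax-∨E a b c) =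
    □ᵢ⇒I [] (□ᵢ⇒I [ a ⇒ᵢ c ] (□ᵢ⇒I ((b ⇒ᵢ c) ∷ (a ⇒ᵢ c) ∷ [])
      (∨E (□ᵢ-elim h₀) (□ᵢ⇒E h₃ h₀) (□ᵢ⇒E h₂ h₀))))
  t-axiom (ax-⊥ a) = □ᵢ⇒I [] (⊥E h₀)
  t-axiom ax-⊤     = ⊤I

  -- The three arrow axioms all translate to this shape. Normality of `□ₘ` lifts the consequence,
  -- and the outer `□ᵢ` can be introduced because the hypothesis is itself a box.
  t-⇝-axiom : ∀ {x y z} → x ∷ y ∷ [] ⊢ z →
    [] ⊢ □ᵢ (□ᵢ (□ᵢ (□ₘ x) ∧ₘ □ᵢ (□ₘ y)) ⇒ₘ □ᵢ (□ₘ z))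
  t-⇝-axiom {x} {y} p = □ᵢ-intro (λ ()) (⇒I (□ᵢ-intro (λ { (here refl) → □ᵢ-persistent })
    (⊢-subst (λ { (here refl)         → □ᵢ-elim (∧E₁ (□ᵢ-elim h₀))
                ; (there (here refl)) → □ᵢ-elim (∧E₂ (□ᵢ-elim h₀)) })
      (□ₘ-nec (x ∷ y ∷ []) p))))

  infix 3 _⊣⊢_
  _⊣⊢_ : MForm → MForm → Set
  a ⊣⊢ b = ([ a ] ⊢ b) × ([ b ] ⊢ a)

  □ᵢ-cong : ∀ {a b} → a ⊣⊢ b → □ᵢ a ⊣⊢ □ᵢ b
  □ᵢ-cong (p , q) = □ᵢ-nec [ _ ] p , □ᵢ-nec [ _ ] q

  □ₘ-cong : ∀ {a b} → a ⊣⊢ b → □ₘ a ⊣⊢ □ₘ b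
  □ₘ-cong (p , q) = □ₘ-nec [ _ ] p , □ₘ-nec [ _ ] q

  ∧-cong : ∀ {a b c d} → a ⊣⊢ b → c ⊣⊢ d → a ∧ₘ c ⊣⊢ b ∧ₘ d
  ∧-cong (p , q) (r , s) =
    ∧I (⊢-trans (∧E₁ h₀) p) (⊢-trans (∧E₂ h₀) r) ,
    ∧I (⊢-trans (∧E₁ h₀) q) (⊢-trans (∧E₂ h₀) s)

  ∨-cong : ∀ {a b c d} → a ⊣⊢ b → c ⊣⊢ d → a ∨ₘ c ⊣⊢ b ∨ₘ d
  ∨-cong (p , q) (r , s) =
    ∨E h₀ (∨I₁ (⊢-trans h₀ p)) (∨I₂ (⊢-trans h₀ r)) ,
    ∨E h₀ (∨I₁ (⊢-trans h₀ q)) (∨I₂ (⊢-trans h₀ s))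

  ⇒-cong : ∀ {a b c d} → a ⊣⊢ b → c ⊣⊢ d → (a ⇒ₘ c) ⊣⊢ (b ⇒ₘ d)
  ⇒-cong (p , q) (r , s) =
    ⇒I (⊢-trans (⇒E h₁ (⊢-trans h₀ q)) r) ,
    ⇒I (⊢-trans (⇒E h₁ (⊢-trans h₀ p)) s)

  -- At a variable the two sides are `□ᵢ (t (σ n))` and `t (σ n)`, equivalent by T and persistence;
  -- congruence does the rest.
  t-isub : ∀ σ φ → msub (t ∘ σ) (t φ) ⊣⊢ t (isub σ φ)
  t-isub σ (var n)  = □ᵢ-elim h₀ , t-persistent (σ n)
  t-isub σ ⊤ᵢ       = h₀ , h₀
  t-isub σ ⊥ᵢ       = h₀ , h₀
  t-isub σ (a ∧ᵢ b) = □ᵢ-cong (∧-cong (t-isub σ a) (t-isub σ b))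
  t-isub σ (a ∨ᵢ b) = □ᵢ-cong (∨-cong (t-isub σ a) (t-isub σ b))
  t-isub σ (a ⇒ᵢ b) = □ᵢ-cong (⇒-cong (t-isub σ a) (t-isub σ b))
  t-isub σ (a ⇝ b)  = □ᵢ-cong (□ₘ-cong (⇒-cong (t-isub σ a) (t-isub σ b)))

  t-sound : ∀ {Γ} → (∀ {γ} → Γ γ → Θ (t γ)) → ∀ {φ} → IA⊕ Γ φ → Θ (t φ)
  t-sound Γ⊆ (ipc x)      = theorem (t-axiom x)
  t-sound Γ⊆ (ax-C a b c) = theorem (t-⇝-axiom
    -- The translated conjunction carries a box, but the implications in the context need not be
    -- persistent. So the box is introduced over `t b` and `t c` alone, which are then derived from
    -- the context.
    (⇒I (⊢-subst (λ { (here refl) → ⇒E h₁ h₀ ; (there (here refl)) → ⇒E h₂ h₀ })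
      (□ᵢ-intro (map-t-persistent (b ∷ c ∷ [])) (∧I h₀ h₁)))))
  t-sound Γ⊆ (ax-D a b c) = theorem (t-⇝-axiom
    (⇒I (∨E (□ᵢ-elim h₀) (⇒E h₂ h₀) (⇒E h₃ h₀))))
  t-sound Γ⊆ (ax-I a b c) = theorem (t-⇝-axiom (⇒I (⇒E h₂ (⇒E h₁ h₀))))
  t-sound Γ⊆ (i-hyp γ)    = Γ⊆ γ
  t-sound Γ⊆ (i-mp p q)   = mp (mp (Tᵢ _) (t-sound Γ⊆ p)) (t-sound Γ⊆ q)
  t-sound Γ⊆ (i-arr p)    = necᵢ (necₘ (mp (Tᵢ _) (t-sound Γ⊆ p)))
  t-sound Γ⊆ (i-usub {φ} σ p) =
    theorem (⊢-trans (thm (usub (t ∘ σ) (t-sound Γ⊆ p))) (proj₁ (t-isub σ φ)))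

-- Decidable equality of formulas

_≟ᵢ_ : (a b : IForm) → Maybe (a ≡ b)
var m ≟ᵢ var n with m ≟ n
... | yes p = just (cong var p)
... | no _  = nothing
⊤ᵢ ≟ᵢ ⊤ᵢ = just refl
⊥ᵢ ≟ᵢ ⊥ᵢ = just refl
(a ∧ᵢ b) ≟ᵢ (c ∧ᵢ d) = zipWith (cong₂ _∧ᵢ_) (a ≟ᵢ c) (b ≟ᵢ d)
(a ∨ᵢ b) ≟ᵢ (c ∨ᵢ d) = zipWith (cong₂ _∨ᵢ_) (a ≟ᵢ c) (b ≟ᵢ d)
(a ⇒ᵢ b) ≟ᵢ (c ⇒ᵢ d) = zipWith (cong₂ _⇒ᵢ_) (a ≟ᵢ c) (b ≟ᵢ d)
(a ⇝ b)  ≟ᵢ (c ⇝ d)  = zipWith (cong₂ _⇝_) (a ≟ᵢ c) (b ≟ᵢ d)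
_ ≟ᵢ _ = nothing

-- Completeness of the partial test on equal formulas; it turns `nothing` into a refutation without
-- a case for each pair of distinct connectives.
≟ᵢ-refl : ∀ a → ∃[ p ] (a ≟ᵢ a) ≡ just p
≟ᵢ-refl (var n) with n ≟ n
... | yes p = _ , refl
... | no ¬p = ⊥-elim (¬p refl)
≟ᵢ-refl ⊤ᵢ = _ , refl
≟ᵢ-refl ⊥ᵢ = _ , refl
≟ᵢ-refl (a ∧ᵢ b) rewrite proj₂ (≟ᵢ-refl a) | proj₂ (≟ᵢ-refl b) = _ , refl
≟ᵢ-refl (a ∨ᵢ b) rewrite proj₂ (≟ᵢ-refl a) | proj₂ (≟ᵢ-refl b) = _ , refl
≟ᵢ-refl (a ⇒ᵢ b) rewrite proj₂ (≟ᵢ-refl a) | proj₂ (≟ᵢ-refl b) = _ , refl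
≟ᵢ-refl (a ⇝ b)  rewrite proj₂ (≟ᵢ-refl a) | proj₂ (≟ᵢ-refl b) = _ , refl

IForm-≡-dec : DecidableEquality IForm
IForm-≡-dec a b with a ≟ᵢ b in eq
... | just p  = yes p
... | nothing = no λ { refl → just≢nothing (trans (sym (proj₂ (≟ᵢ-refl a))) eq) }
  where
  just≢nothing : ∀ {p : a ≡ a} → just p ≡ nothing → ⊥
  just≢nothing ()

open import Data.List.Membership.DecPropositional IForm-≡-dec using (_∈?_)

-- Clauses and conjunctive normal forms

-- (xs , ys) stands for ⋀ xs → ⋁ ys in the free Boolean extension.
Clause : Set
Clause = List IForm × List IForm

CNF : Set
CNF = List Clause

infixl 6 _⊔_
_⊔_ : Clause → Clause → Clause
(xs , ys) ⊔ (xs' , ys') = xs ++ xs' , ys ++ ys'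

-- As a clause this is ⊤ → ⊥, hence falsity. On the left of `_⊩_` it is the top element, so `∅ ⊩ e`
-- says that `e` is valid.
∅ : Clause
∅ = [] , []

pos neg : IForm → Clause
pos a = [] , [ a ]
neg a = [ a ] , []

negClause : Clause → CNF
negClause (xs , ys) = map pos xs ++ map neg ys

_∨ᶜ_ : CNF → CNF → CNF
_∨ᶜ_ = cartesianProductWith _⊔_

-- De Morgan: the join of the negated clauses, each negated clause being a meet of unit clauses.
¬ᶜ : CNF → CNF
¬ᶜ []      = [ ∅ ]
¬ᶜ (c ∷ e) = negClause c ∨ᶜ ¬ᶜ e

_⇒ᶜ_ : CNF → CNF → CNF
e ⇒ᶜ f = ¬ᶜ e ∨ᶜ f

infix 4 _⊑_
_⊑_ : Clause → Clause → Set
c ⊑ d = (proj₁ c ⊆ proj₁ d) × (proj₂ c ⊆ proj₂ d)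

⊑-refl : ∀ {c} → c ⊑ c
⊑-refl = id , id

⊑-trans : ∀ {c d e} → c ⊑ d → d ⊑ e → c ⊑ e
⊑-trans (p , q) (r , s) = r ∘ p , s ∘ q

⊑-⊔₁ : ∀ {c d} → c ⊑ c ⊔ d
⊑-⊔₁ = ∈-++⁺ˡ , ∈-++⁺ˡ

⊑-⊔₂ : ∀ {c d} → d ⊑ c ⊔ d
⊑-⊔₂ {xs , ys} = ∈-++⁺ʳ xs , ∈-++⁺ʳ ys

⊔-lub : ∀ {c d e} → c ⊑ e → d ⊑ e → c ⊔ d ⊑ e
⊔-lub {xs , ys} (p , q) (r , s) =
  (λ i → [ p , r ]′ (∈-++⁻ xs i)) , (λ i → [ q , s ]′ (∈-++⁻ ys i))

⊔-mono : ∀ {c c' d d'} → c ⊑ c' → d ⊑ d' → c ⊔ d ⊑ c' ⊔ d'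
⊔-mono {c' = c'} p q = ⊔-lub (⊑-trans p ⊑-⊔₁) (⊑-trans q (⊑-⊔₂ {c'}))

⊔-swap : ∀ c d e → c ⊔ d ⊔ e ⊑ c ⊔ e ⊔ d
⊔-swap c d e = ⊔-lub {c ⊔ d} {e} (⊔-mono {d = d} (⊑-⊔₁ {c}) ⊑-refl) (⊑-trans (⊑-⊔₂ {c}) (⊑-⊔₁ {c ⊔ e}))

⊔-assocˡ : ∀ c d e → c ⊔ (d ⊔ e) ⊑ c ⊔ d ⊔ e
⊔-assocˡ c d e = ⊔-lub {c} {d ⊔ e} (⊑-trans (⊑-⊔₁ {c}) (⊑-⊔₁ {c ⊔ d})) (⊔-mono {d = e} (⊑-⊔₂ {c}) ⊑-refl)

⊔-assocʳ : ∀ c d e → c ⊔ d ⊔ e ⊑ c ⊔ (d ⊔ e)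
⊔-assocʳ c d e = ⊔-lub {c ⊔ d} {e} (⊔-mono {c} {c} {d} ⊑-refl (⊑-⊔₁ {d})) (⊑-trans (⊑-⊔₂ {d}) (⊑-⊔₂ {c}))

-- Boolean evaluation of normal forms

module Evaluation (w : IForm → Bool) where

  evalC : Clause → Bool
  evalC (xs , ys) = not (all w xs) ∨ any w ys

  eval : CNF → Bool
  eval = all evalC

  all-++ : ∀ {A : Set} (p : A → Bool) xs ys → all p (xs ++ ys) ≡ all p xs ∧ all p ys
  all-++ p []       ys = refl
  all-++ p (x ∷ xs) ys = trans (cong (p x ∧_) (all-++ p xs ys)) (sym (∧-assoc (p x) _ _))

  any-++ : ∀ {A : Set} (p : A → Bool) xs ys → any p (xs ++ ys) ≡ any p xs ∨ any p ys
  any-++ p []       ys = refl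
  any-++ p (x ∷ xs) ys = trans (cong (p x ∨_) (any-++ p xs ys)) (sym (∨-assoc (p x) _ _))

  evalC-⊔ : ∀ c d → evalC (c ⊔ d) ≡ evalC c ∨ evalC d
  evalC-⊔ (xs , ys) (xs' , ys') rewrite all-++ w xs xs' | any-++ w ys ys' =
    regroup (all w xs) (all w xs') (any w ys) (any w ys')
    where
    regroup : ∀ a b c d → not (a ∧ b) ∨ (c ∨ d) ≡ (not a ∨ c) ∨ (not b ∨ d)
    regroup false b     c     d = refl
    regroup true  true  c     d = refl
    regroup true  false false d = refl
    regroup true  false true  d = refl

  eval-⊔ : ∀ c f → eval (map (c ⊔_) f) ≡ evalC c ∨ eval f
  eval-⊔ c []      = sym (∨-zeroʳ (evalC c))
  eval-⊔ c (d ∷ f) rewrite evalC-⊔ c d | eval-⊔ c f = sym (∨-distribˡ-∧ (evalC c) (evalC d) (eval f))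

  eval-∨ᶜ : ∀ e f → eval (e ∨ᶜ f) ≡ eval e ∨ eval f
  eval-∨ᶜ []      f = refl
  eval-∨ᶜ (c ∷ e) f rewrite all-++ evalC (map (c ⊔_) f) (e ∨ᶜ f) | eval-⊔ c f | eval-∨ᶜ e f =
    sym (∨-distribʳ-∧ (eval f) (evalC c) (eval e))

  eval-pos : ∀ xs → eval (map pos xs) ≡ all w xs
  eval-pos []       = refl
  eval-pos (x ∷ xs) rewrite eval-pos xs | ∨-identityʳ (w x) = refl

  eval-neg : ∀ ys → eval (map neg ys) ≡ not (any w ys)
  eval-neg []       = refl
  eval-neg (y ∷ ys) rewrite eval-neg ys with w y
  ... | true  = refl
  ... | false = refl

  eval-negClause : ∀ c → eval (negClause c) ≡ not (evalC c)
  eval-negClause (xs , ys)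
    rewrite all-++ evalC (map pos xs) (map neg ys) | eval-pos xs | eval-neg ys with all w xs
  ... | true  = refl
  ... | false = refl

  eval-¬ᶜ : ∀ e → eval (¬ᶜ e) ≡ not (eval e)
  eval-¬ᶜ []      = refl
  eval-¬ᶜ (c ∷ e) rewrite eval-∨ᶜ (negClause c) (¬ᶜ e) | eval-negClause c | eval-¬ᶜ e with evalC c
  ... | true  = refl
  ... | false = refl

  eval-⇒ᶜ : ∀ e f → eval (e ⇒ᶜ f) ≡ not (eval e) ∨ eval f
  eval-⇒ᶜ e f rewrite eval-∨ᶜ (¬ᶜ e) f | eval-¬ᶜ e = refl

  eval-atom : ∀ a → eval [ pos a ] ≡ w a
  eval-atom a rewrite ∨-identityʳ (w a) = ∧-identityʳ (w a)

-- The free Boolean extension of the Lindenbaum algebra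

module BooleanExtension (Γ : IForm → Set) where

  open Deduction _∧ᵢ_ _∨ᵢ_ _⇒ᵢ_ ⊤ᵢ ⊥ᵢ (IA⊕ Γ) i-mp
    (λ a b → ipc (ax-K a b)) (λ a b c → ipc (ax-S a b c))
    (λ a b → ipc (ax-∧I a b)) (λ a b → ipc (ax-∧E₁ a b)) (λ a b → ipc (ax-∧E₂ a b))
    (λ a b → ipc (ax-∨I₁ a b)) (λ a b → ipc (ax-∨I₂ a b)) (λ a b c → ipc (ax-∨E a b c))
    (λ a → ipc (ax-⊥ a)) (ipc ax-⊤)

  record Entails (c : Clause) : Set where
    constructor ⟪_⟫
    field derivation : proj₁ c ⊢ ⋁ (proj₂ c)
  open Entails

  Entails-mono : ∀ {c d} → c ⊑ d → Entails c → Entails d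
  Entails-mono {_ , ys} (p , q) ⟪ s ⟫ = ⟪ ⋁E ys (⊢-weaken p s) (λ i → ⋁I (q i) h₀) ⟫

  Entails-id : ∀ {c x} → x ∈ proj₁ c → x ∈ proj₂ c → Entails c
  Entails-id i j = ⟪ ⋁I j (hyp i) ⟫

  ⊔-∅ : ∀ w → w ⊔ ∅ ⊑ w
  ⊔-∅ w = ⊔-lub {w} {∅} ⊑-refl ((λ ()) , λ ())

  -- Case analysis on ⋁ys ∨ a, that is, distributivity of H. It lets elements of H behave
  -- classically in the extension.
  cut : ∀ w a → Entails (w ⊔ pos a) → Entails (w ⊔ neg a) → Entails w
  cut w@(xs , ys) a p q = ⟪ ⋁E (ys ++ [ a ]) (⊢-weaken (proj₁ (⊔-∅ w)) (derivation p)) branch ⟫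
    where
    branch : ∀ {y} → y ∈ ys ++ [ a ] → y ∷ xs ⊢ ⋁ ys
    branch i with ∈-++⁻ ys i
    ... | inj₁ j           = ⋁I j h₀
    ... | inj₂ (here refl) = derivation (Entails-mono
      ((λ i → [ there , (λ { (here refl) → here refl }) ]′ (∈-++⁻ xs i)) , proj₂ (⊔-∅ w)) q)

  -- The literals of `c` are cut away one at a time, each against the unit clause of opposite sign
  -- in `negClause c`.
  clause-cut : ∀ w c → (∀ {n} → n ∈ negClause c → Entails (w ⊔ n)) → Entails (w ⊔ c) → Entails w
  clause-cut w ([] , []) p s = Entails-mono (⊔-∅ w) s
  clause-cut w ([] , y ∷ ys) p s = clause-cut w ([] , ys) (p ∘ there)
    (cut (w ⊔ c) y
      (Entails-mono (⊑-trans (⊔-mono {w} ⊑-refl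
        ((λ ()) , λ { (here refl) → ∈-++⁺ʳ ys (here refl) ; (there i) → ∈-++⁺ˡ i })) (⊔-assocˡ w c (pos y))) s)
      (Entails-mono (⊔-mono {d = neg y} (⊑-⊔₁ {w}) ⊑-refl) (p (here refl))))
    where
    c = [] , ys
  clause-cut w (x ∷ xs , ys) p s = clause-cut w (xs , ys) (p ∘ there)
    (cut (w ⊔ c) x
      (Entails-mono (⊔-mono {d = pos x} (⊑-⊔₁ {w}) ⊑-refl) (p (here refl)))
      (Entails-mono (⊑-trans (⊔-mono {w} ⊑-refl
        ((λ { (here refl) → ∈-++⁺ʳ xs (here refl) ; (there i) → ∈-++⁺ˡ i }) , ∈-++⁺ˡ)) (⊔-assocˡ w c (neg x))) s))
    where
    c = xs , ys

  -- w ⊩ e says that ⋀xs ∧ ¬⋁ys lies below e, for w = (xs , ys).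
  infix 3 _⊩_
  record _⊩_ (w : Clause) (e : CNF) : Set where
    constructor each
    field clause : ∀ {c} → c ∈ e → Entails (w ⊔ c)
  open _⊩_

  ⊩-mono : ∀ {w w' e} → w ⊑ w' → w ⊩ e → w' ⊩ e
  ⊩-mono {w} le p = each λ {c} i → Entails-mono (⊔-mono {w} {d = c} le ⊑-refl) (clause p i)

  ⊩-⊆ : ∀ {w e f} → f ⊆ e → w ⊩ e → w ⊩ f
  ⊩-⊆ s p = each (clause p ∘ s)

  ⊩-++ : ∀ {w} e {f} → w ⊩ e → w ⊩ f → w ⊩ e ++ f
  ⊩-++ e p q = each λ i → [ clause p , clause q ]′ (∈-++⁻ e i)

  -- Residuation: on the left of `_⊩_`, joining `c` to `w` means w ∧ ¬c, and w lies below c ∨ f iff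
  -- w ∧ ¬c lies below f.
  ⊩-∨ᶜ-intro : ∀ {w} e f → (∀ {c} → c ∈ e → w ⊔ c ⊩ f) → w ⊩ e ∨ᶜ f
  ⊩-∨ᶜ-intro {w} e f p = each go
    where
    go : ∀ {k} → k ∈ e ∨ᶜ f → Entails (w ⊔ k)
    go i with ∈-cartesianProductWith⁻ _⊔_ e f i
    ... | c , d , ci , di , refl = Entails-mono (⊔-assocʳ w c d) (clause (p ci) di)

  ⊩-∨ᶜ-elim : ∀ {w} e f {c} → w ⊩ e ∨ᶜ f → c ∈ e → w ⊔ c ⊩ f
  ⊩-∨ᶜ-elim {w} e f {c} p ci = each λ {d} di →
    Entails-mono (⊔-assocˡ w c d) (clause p (∈-cartesianProductWith⁺ _⊔_ ci di))

  ∈-negClause : ∀ c {n} → n ∈ negClause c → Entails (n ⊔ c)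
  ∈-negClause (xs , ys) i with ∈-++⁻ (map pos xs) i
  ∈-negClause (xs , ys) i | inj₁ j with ∈-map⁻ pos j
  ... | x , xi , refl = Entails-id xi (here refl)
  ∈-negClause (xs , ys) i | inj₂ j with ∈-map⁻ neg j
  ... | y , yi , refl = Entails-id (here refl) yi

  -- The clause `m` lies above ¬e; on the left of `_⊩_` it denotes its own complement, which
  -- therefore lies below e.
  ∈-¬ᶜ : ∀ e {m} → m ∈ ¬ᶜ e → m ⊩ e
  ∈-¬ᶜ []      i = each λ ()
  ∈-¬ᶜ (k ∷ e) i with ∈-cartesianProductWith⁻ _⊔_ (negClause k) (¬ᶜ e) i
  ... | n , m , ni , mi , refl = each λ
    { (here refl) → Entails-mono (⊔-mono {n} {d = k} (⊑-⊔₁ {n}) ⊑-refl) (∈-negClause k ni)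
    ; (there di)  → clause (⊩-mono (⊑-⊔₂ {n}) (∈-¬ᶜ e mi)) di }

  ¬ᶜ-elim : ∀ {w} e → w ⊩ e → w ⊩ ¬ᶜ e → Entails w
  ¬ᶜ-elim {w} []      p q = Entails-mono (⊔-∅ w) (clause q (here refl))
  ¬ᶜ-elim {w} (c ∷ e) p q = ¬ᶜ-elim e (⊩-⊆ there p) (each λ {m} mi →
    clause-cut (w ⊔ m) c
      (λ {n} ni → Entails-mono (⊔-swap w n m) (clause (⊩-∨ᶜ-elim (negClause c) (¬ᶜ e) q ni) mi))
      (Entails-mono (⊔-mono {w} {d = c} (⊑-⊔₁ {w}) ⊑-refl) (clause p (here refl))))

  ¬ᶜ-intro : ∀ {w} e → (∀ {w'} → w ⊑ w' → w' ⊩ e → Entails w') → w ⊩ ¬ᶜ e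
  ¬ᶜ-intro {w} e p = each λ {m} mi → p (⊑-⊔₁ {w}) (⊩-mono (⊑-⊔₂ {w}) (∈-¬ᶜ e mi))

  -- The Kripke-style premise is applied at the extensions `w ⊔ m` with `m ∈ ¬ᶜ e`, which force `e`
  -- by `∈-¬ᶜ`.
  ⇒ᶜ-intro : ∀ {w} e f → (∀ {w'} → w ⊑ w' → w' ⊩ e → w' ⊩ f) → w ⊩ e ⇒ᶜ f
  ⇒ᶜ-intro {w} e f p = ⊩-∨ᶜ-intro (¬ᶜ e) f λ mi → p (⊑-⊔₁ {w}) (⊩-mono (⊑-⊔₂ {w}) (∈-¬ᶜ e mi))

  ⇒ᶜ-elim : ∀ {w} e f → w ⊩ e ⇒ᶜ f → w ⊩ e → w ⊩ f
  ⇒ᶜ-elim {w} e f p q = each λ {c} ci → ¬ᶜ-elim e (⊩-mono (⊑-⊔₁ {w}) q) (each λ {m} mi →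
    Entails-mono (⊔-swap w m c) (clause (⊩-∨ᶜ-elim (¬ᶜ e) f p mi) ci))

  -- Each clause (xs, ys) of `e` is tested at the valuation making exactly the members of `xs` true.
  -- Some member of `ys` is then true, so it lies in `xs` and the sequent is an identity.
  tautology : ∀ e → (∀ w → Evaluation.eval w e ≡ true) → ∅ ⊩ e
  tautology e valid = each entailed
    where
    entailed : ∀ {c} → c ∈ e → Entails c
    entailed {xs , ys} ci = ⟪ common ys any-ys ⟫
      where
      w : IForm → Bool
      w z = ⌊ z ∈? xs ⌋

      open Evaluation w using (evalC)

      all-∈ : ∀ f → all evalC f ≡ true → ∀ {d} → d ∈ f → evalC d ≡ true
      all-∈ (d ∷ f) q (here refl) with evalC d
      ... | true = refl
      all-∈ (d ∷ f) q (there i) with evalC d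
      ... | true = all-∈ f q i

      all-xs : ∀ zs → zs ⊆ xs → all w zs ≡ true
      all-xs []       s = refl
      all-xs (z ∷ zs) s with z ∈? xs
      ... | yes _ = all-xs zs (s ∘ there)
      ... | no ¬i = ⊥-elim (¬i (s (here refl)))

      any-ys : any w ys ≡ true
      any-ys = trans (sym (cong (λ b → not b ∨ any w ys) (all-xs xs id))) (all-∈ e (valid w) ci)

      common : ∀ zs → any w zs ≡ true → xs ⊢ ⋁ zs
      common (z ∷ zs) q with z ∈? xs
      ... | yes i = ∨I₁ (hyp i)
      ... | no _  = ∨I₂ (common zs q)

  -- The order on normal forms and the embedded copy of H.

  infix 3 _≼_ _≈_
  _≼_ _≈_ : CNF → CNF → Set
  e ≼ f = ∀ {w} → w ⊩ e → w ⊩ f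
  e ≈ f = (e ≼ f) × (f ≼ e)

  atom : IForm → CNF
  atom a = [ pos a ]

  ⊢⇒⊩ : ∀ {L a} → L ⊢ a → L , [] ⊩ atom a
  ⊢⇒⊩ p = each λ { (here refl) → ⟪ ∨I₁ (⊢-weaken ∈-++⁺ˡ p) ⟫ }

  ⊩⇒⊢ : ∀ {L a} → L , [] ⊩ atom a → L ⊢ a
  ⊩⇒⊢ {L} p = ∨E (⊢-weaken (proj₁ (⊔-∅ (L , []))) (derivation (clause p (here refl)))) h₀ (⊥E h₀)

  ⊩-hyp : ∀ {w a} → a ∈ proj₁ w → w ⊩ atom a
  ⊩-hyp {w} i = each λ { (here refl) → Entails-id (∈-++⁺ˡ i) (∈-++⁺ʳ (proj₂ w) (here refl)) }

  ⊩-cut : ∀ {w} X {e} → (∀ {x} → x ∈ X → w ⊩ atom x) → X , [] ⊩ e → w ⊩ e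
  ⊩-cut {w} X {e} p q = each λ {c} ci → clause-cut (w ⊔ c) (X , []) (premise c)
    (Entails-mono (⊔-lub {X , []} {c} (⊑-⊔₂ {w ⊔ c}) (⊑-trans (⊑-⊔₂ {w}) (⊑-⊔₁ {w ⊔ c}))) (clause q ci))
    where
    premise : ∀ c {n} → n ∈ negClause (X , []) → Entails (w ⊔ c ⊔ n)
    premise c i with ∈-++⁻ (map pos X) i
    ... | inj₁ j with ∈-map⁻ pos j
    ...   | x , xi , refl = Entails-mono (⊔-mono {w} {d = pos x} (⊑-⊔₁ {w}) ⊑-refl) (clause (p xi) (here refl))

  ⊩-⊢ : ∀ {w} X {a} → (∀ {x} → x ∈ X → w ⊩ atom x) → X ⊢ a → w ⊩ atom a
  ⊩-⊢ X p q = ⊩-cut X p (⊢⇒⊩ q)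

  atom-elim : ∀ {w a e} → w ⊩ atom a → [ a ] , [] ⊩ e → w ⊩ e
  atom-elim {a = a} p = ⊩-cut [ a ] λ { (here refl) → p }

  -- The boxes of the extension

  I M : CNF → IForm
  I e = ⋀ (map (λ c → ⋀ (proj₁ c) ⇒ᵢ ⋁ (proj₂ c)) e)
  M e = ⋀ (map (λ c → ⋀ (proj₁ c) ⇝ ⋁ (proj₂ c)) e)

  ⋀-map-I : ∀ {L} (g : Clause → IForm) e → (∀ {c} → c ∈ e → L ⊢ g c) → L ⊢ ⋀ (map g e)
  ⋀-map-I g []      p = ⊤I
  ⋀-map-I g (c ∷ e) p = ∧I (p (here refl)) (⋀-map-I g e (p ∘ there))

  -- The left side must come from H: with no negative part, the premises of each clause can be
  -- discharged into an intuitionistic implication.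
  I-intro : ∀ {L} e → L , [] ⊩ e → L ⊢ I e
  I-intro {L} e p = ⋀-map-I _ e λ {c} i → ⇒I (⊢-subst (premise c) (derivation (clause p i)))
    where
    premise : ∀ c {x} → x ∈ L ++ proj₁ c → ⋀ (proj₁ c) ∷ L ⊢ x
    premise c i = [ hyp ∘ there , (λ j → ⋀E j h₀) ]′ (∈-++⁻ L i)

  I-elim : ∀ {L} e → L ⊢ I e → L , [] ⊩ e
  I-elim {L} e p = each λ {c} i →
    ⟪ ⇒E (⋀E (∈-map⁺ _ i) (⊢-weaken ∈-++⁺ˡ p)) (⋀I (proj₁ c) (hyp ∘ ∈-++⁺ʳ L)) ⟫

  I-≼ : ∀ e → atom (I e) ≼ e
  I-≼ e p = atom-elim p (I-elim e h₀)

  -- Identifies a boxed value by its universal property: `I e` is the largest element of H below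
  -- `e`.
  I-greatest : ∀ e {a} → ([ a ] , [] ⊩ e) → (∀ {L} → L , [] ⊩ e → L ⊢ a) → atom (I e) ≈ atom a
  I-greatest e p q =
    (λ r → atom-elim r (⊢⇒⊩ (q (I-elim e h₀)))) ,
    (λ r → atom-elim r (⊢⇒⊩ (I-intro e p)))

  -- Reasoning under the arrow and monotonicity of `M`.

  ⇝-thm : ∀ {L a b} → [ a ] ⊢ b → L ⊢ a ⇝ b
  ⇝-thm p = thm (i-arr (theorem (⇒I p)))

  ⇝-trans : ∀ {L a b c} → L ⊢ a ⇝ b → L ⊢ b ⇝ c → L ⊢ a ⇝ c
  ⇝-trans p q = ⇒E (thm (ax-I _ _ _)) (∧I p q)

  ⇝-∧ : ∀ {L a b c} → L ⊢ a ⇝ b → L ⊢ a ⇝ c → L ⊢ a ⇝ (b ∧ᵢ c)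
  ⇝-∧ p q = ⇒E (thm (ax-C _ _ _)) (∧I p q)

  ⇝-∨ : ∀ {L a b c} → L ⊢ a ⇝ c → L ⊢ b ⇝ c → L ⊢ (a ∨ᵢ b) ⇝ c
  ⇝-∨ p q = ⇒E (thm (ax-D _ _ _)) (∧I p q)

  -- Cut under the arrow: x is distributed over k ∨ y, the branch k ∧ x is sent to l ∧ x, and the
  -- two branches rejoin at y.
  ⇝-resolve : ∀ {L x y k l} → L ⊢ x ⇝ (k ∨ᵢ y) → L ⊢ k ⇝ l → L ⊢ (l ∧ᵢ x) ⇝ y → L ⊢ x ⇝ y
  ⇝-resolve {k = k} p q r =
    ⇝-trans (⇝-∧ (⇝-thm h₀) p)
    (⇝-trans (⇝-thm (∨E (∧E₂ h₀) (∨I₁ (∧I h₀ (∧E₁ h₁))) (∨I₂ h₀)))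
    (⇝-∨ (⇝-trans (⇝-∧ (⇝-trans (⇝-thm (∧E₁ {a = k} h₀)) q) (⇝-thm (∧E₂ h₀))) r) (⇝-thm h₀)))

  -- Resolves the clauses of e away one at a time, so that M is monotone, hence
  -- well defined, on the Boolean extension.
  M-arrow : ∀ e xs ys → (xs , ys) ⊩ ¬ᶜ e → [ M e ] ⊢ ⋀ xs ⇝ ⋁ ys
  M-arrow [] xs ys p = ⇝-thm (⊢-subst (λ i → ⋀E i h₀)
    (derivation (Entails-mono (⊔-∅ (xs , ys)) (clause p (here refl)))))
  -- The first conjunct of `M` is ⋀ks ⇝ ⋁ls. The recursive calls, with ⋀ks as a further conclusion
  -- and with ⋁ls as a further premise, supply the other two arrows of the resolution.
  M-arrow ((ks , ls) ∷ e) xs ys p = ⇝-resolve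
    (⊢-trans (∧E₂ h₀) (M-arrow e xs (⋀ ks ∷ ys) (each right)))
    (∧E₁ h₀)
    (⊢-trans (∧E₂ h₀) (M-arrow e (⋁ ls ∷ xs) ys (each left)))
    where
    w = xs , ys
    premise : ∀ {w' m n} → w ⊑ w' → n ∈ negClause (ks , ls) → m ∈ ¬ᶜ e → Entails (w' ⊔ m ⊔ n)
    premise {w'} {m} {n} le ni mi = Entails-mono
      (⊑-trans (⊔-swap w n m) (⊔-mono {w ⊔ m} {d = n} (⊔-mono {w} {d = m} le ⊑-refl) ⊑-refl))
      (clause (⊩-∨ᶜ-elim (negClause (ks , ls)) (¬ᶜ e) p ni) mi)

    negs : ∀ {n} → n ∈ negClause (ks , []) → n ∈ negClause (ks , ls)
    negs i = ∈-++⁺ˡ ([ id , (λ ()) ]′ (∈-++⁻ (map pos ks) i))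

    right : ∀ {m} → m ∈ ¬ᶜ e → Entails ((xs , ⋀ ks ∷ ys) ⊔ m)
    right {m} mi = clause-cut ((xs , ⋀ ks ∷ ys) ⊔ m) (ks , [])
      (λ ni → premise (id , there) (negs ni) mi)
      ⟪ ∨I₁ (⋀I ks (hyp ∘ ∈-++⁺ʳ (xs ++ proj₁ m))) ⟫

    left : ∀ {m} → m ∈ ¬ᶜ e → Entails ((⋁ ls ∷ xs , ys) ⊔ m)
    left {m} mi = clause-cut ((⋁ ls ∷ xs , ys) ⊔ m) ([] , ls)
      (λ ni → premise (there , id) (∈-++⁺ʳ (map pos ks) ni) mi)
      ⟪ ⋁E ls h₀ (λ i → ⋁I (∈-++⁺ʳ (ys ++ proj₂ m) i) h₀) ⟫

  -- By contraposition: for a clause `c` of `f`, the inequality e ≤ c reads `c ⊩ ¬ᶜ e`, the form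
  -- that `M-arrow` takes.
  M-mono : ∀ {e f} → e ≼ f → [ M e ] ⊢ M f
  M-mono {e} {f} p = ⋀-map-I _ f λ {c} ci → M-arrow e (proj₁ c) (proj₂ c) (¬ᶜ-intro e λ {w'} le q →
    Entails-mono (⊔-lub {w'} ⊑-refl le) (clause (p q) ci))

  M-++ : ∀ {L} e f → L ⊢ M e → L ⊢ M f → L ⊢ M (e ++ f)
  M-++ e f p q = ⋀-map-I _ (e ++ f) λ i → [ (λ j → ⋀E (∈-map⁺ _ j) p) , (λ j → ⋀E (∈-map⁺ _ j) q) ]′ (∈-++⁻ e i)

  -- Going up in H, e can turn from false to true only by some ⋁ ls becoming true,
  -- which satisfies the clause (ks , ls) from then on, so e alternates finitely
  -- often. K lists the clauses that need not be satisfied yet.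
  grz : ∀ e → atom (I (atom (I (e ⇒ᶜ atom (I e))) ⇒ᶜ e)) ≼ e
  grz e p = atom-elim p (⊩-mono ((λ { (here refl) → here refl }) , id) (resolve e [] inj₁))
    where
    q u : IForm
    q = I (e ⇒ᶜ atom (I e))
    u = I (atom q ⇒ᶜ e)

    -- Induction on `K`: the head clause is shown to hold under `u`, after which the tail is treated
    -- with `u` added to the context; the duplicate `u` is contracted.
    resolve : ∀ K L → (∀ {c} → c ∈ e → c ∈ K ⊎ Entails ((L , []) ⊔ c)) → u ∷ L , [] ⊩ e
    resolve [] L s = each λ ci → [ (λ ()) , Entails-mono (there , id) ]′ (s ci)
    resolve (k@(ks , ls) ∷ K) L s = ⊩-mono ((λ { (here e) → here e ; (there i) → i }) , id)
      (resolve K (u ∷ L) λ ci → dispatch ci (s ci))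
      where
      L' : List IForm
      L' = u ∷ L ++ ks

      after : ∀ {c} → c ∈ k ∷ K ⊎ Entails ((L , []) ⊔ c) → c ∈ K ⊎ Entails ((⋁ ls ∷ L' , []) ⊔ c)
      after (inj₁ (here refl)) = inj₂ ⟪ h₀ ⟫
      after (inj₁ (there i))   = inj₁ i
      after {c} (inj₂ r)       = inj₂ (Entails-mono (⊔-mono {d = c} (there ∘ there ∘ ∈-++⁺ˡ , id) ⊑-refl) r)

      after-I : u ∷ ⋁ ls ∷ L' ⊢ I e
      -- The context lies in H, so `I-intro` applies; the result is only later weakened to a `w`
      -- that may have a negative part.
      after-I = I-intro e (resolve K (⋁ ls ∷ L') (after ∘ s))

      -- With `ks` available, any extension forcing `e` yields ⋁ls through the clause `k`. Cutting
      -- on ⋁ls leads to `after-I`.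
      q-holds : k ∈ e → L' ⊢ q
      q-holds ki = I-intro (e ⇒ᶜ atom (I e)) (⇒ᶜ-intro e (atom (I e)) λ {w} le r → each λ
        { (here refl) → cut (w ⊔ pos (I e)) (⋁ ls)
            ⟪ ⋁E (proj₂ w ++ ls)
                (⊢-weaken (λ i → ∈-++⁺ˡ (∈-++⁺ˡ ([ id , proj₁ le ∘ there ∘ ∈-++⁺ʳ L ]′ (∈-++⁻ (proj₁ w) i))))
                  (derivation (clause r ki)))
                (λ i → [ (λ j → ⋁I (∈-++⁺ˡ (∈-++⁺ˡ j)) h₀)
                       , (λ j → ⋁I (∈-++⁺ʳ (proj₂ w ++ [ I e ]) (here refl)) (⋁I j h₀)) ]′ (∈-++⁻ (proj₂ w) i)) ⟫
            ⟪ ⋁I (∈-++⁺ˡ (∈-++⁺ʳ (proj₂ w) (here refl)))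
                (⊢-weaken (λ { (here refl)         → ∈-++⁺ˡ (∈-++⁺ˡ (proj₁ le (here refl)))
                             ; (there (here refl)) → ∈-++⁺ʳ (proj₁ w ++ []) (here refl)
                             ; (there (there i))   → ∈-++⁺ˡ (∈-++⁺ˡ (proj₁ le i)) }) after-I) ⟫ })

      -- The premises of `k` may be assumed. They give `q`, then `u` gives `e`, and its clause `k`
      -- delivers ⋁ls.
      step : k ∈ e → Entails ((u ∷ L , []) ⊔ k)
      step ki = Entails-mono
        ((λ i → [ id , there ∘ ∈-++⁺ʳ L ]′ (∈-++⁻ L' i)) , id)
        (clause (⇒ᶜ-elim (atom q) e (I-elim (atom q ⇒ᶜ e) h₀) (⊢⇒⊩ (q-holds ki))) ki)

      dispatch : ∀ {c} → c ∈ e → c ∈ k ∷ K ⊎ Entails ((L , []) ⊔ c) → c ∈ K ⊎ Entails ((u ∷ L , []) ⊔ c)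
      dispatch ci (inj₁ (here refl)) = inj₂ (step ci)
      dispatch ci (inj₁ (there i))   = inj₁ i
      dispatch ci (inj₂ r)           = inj₂ (Entails-mono (there , id) r)

  -- Interpretation of bimodal formulas

  ⟦_⟧ : MForm → (ℕ → CNF) → CNF
  ⟦ mvar n ⟧ v = v n
  ⟦ ⊤ₘ ⟧     v = []
  ⟦ ⊥ₘ ⟧     v = [ ∅ ]
  ⟦ a ∧ₘ b ⟧ v = ⟦ a ⟧ v ++ ⟦ b ⟧ v
  ⟦ a ∨ₘ b ⟧ v = ⟦ a ⟧ v ∨ᶜ ⟦ b ⟧ v
  ⟦ a ⇒ₘ b ⟧ v = ⟦ a ⟧ v ⇒ᶜ ⟦ b ⟧ v
  ⟦ □ᵢ a ⟧   v = atom (I (⟦ a ⟧ v))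
  ⟦ □ₘ a ⟧   v = atom (M (⟦ a ⟧ v))

  ⟦msub⟧ : ∀ σ φ v → ⟦ msub σ φ ⟧ v ≡ ⟦ φ ⟧ (λ n → ⟦ σ n ⟧ v)
  ⟦msub⟧ σ (mvar n) v = refl
  ⟦msub⟧ σ ⊤ₘ       v = refl
  ⟦msub⟧ σ ⊥ₘ       v = refl
  ⟦msub⟧ σ (a ∧ₘ b) v = cong₂ _++_ (⟦msub⟧ σ a v) (⟦msub⟧ σ b v)
  ⟦msub⟧ σ (a ∨ₘ b) v = cong₂ _∨ᶜ_ (⟦msub⟧ σ a v) (⟦msub⟧ σ b v)
  ⟦msub⟧ σ (a ⇒ₘ b) v = cong₂ _⇒ᶜ_ (⟦msub⟧ σ a v) (⟦msub⟧ σ b v)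
  ⟦msub⟧ σ (□ᵢ a)   v = cong (atom ∘ I) (⟦msub⟧ σ a v)
  ⟦msub⟧ σ (□ₘ a)   v = cong (atom ∘ M) (⟦msub⟧ σ a v)

  -- `evalB` treats boxed formulas as atoms, and their interpretations are single elements of H,
  -- which `w` evaluates.
  boxValue : (ℕ → CNF) → (IForm → Bool) → MForm → Bool
  boxValue v w (□ᵢ a) = w (I (⟦ a ⟧ v))
  boxValue v w (□ₘ a) = w (M (⟦ a ⟧ v))
  boxValue v w _      = true

  eval-⟦⟧ : ∀ w v φ → Evaluation.eval w (⟦ φ ⟧ v) ≡ evalB (Evaluation.eval w ∘ v) (boxValue v w) φ
  eval-⟦⟧ w v (mvar n) = refl
  eval-⟦⟧ w v ⊤ₘ       = refl
  eval-⟦⟧ w v ⊥ₘ       = refl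
  eval-⟦⟧ w v (a ∧ₘ b) = trans (all-++ evalC (⟦ a ⟧ v) (⟦ b ⟧ v)) (cong₂ _∧_ (eval-⟦⟧ w v a) (eval-⟦⟧ w v b))
    where open Evaluation w
  eval-⟦⟧ w v (a ∨ₘ b) = trans (eval-∨ᶜ (⟦ a ⟧ v) (⟦ b ⟧ v)) (cong₂ _∨_ (eval-⟦⟧ w v a) (eval-⟦⟧ w v b))
    where open Evaluation w
  eval-⟦⟧ w v (a ⇒ₘ b) =
    trans (eval-⇒ᶜ (⟦ a ⟧ v) (⟦ b ⟧ v)) (cong₂ (λ x y → not x ∨ y) (eval-⟦⟧ w v a) (eval-⟦⟧ w v b))
    where open Evaluation w
  eval-⟦⟧ w v (□ᵢ a)   = Evaluation.eval-atom w (I (⟦ a ⟧ v))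
  eval-⟦⟧ w v (□ₘ a)   = Evaluation.eval-atom w (M (⟦ a ⟧ v))

  -- The value of a translated formula

  -- Reduces the implication to one clause, on which the boxes can be read off as `a ⇒ᵢ b` and
  -- `a ⇝ b` up to units.
  ⇒ᶜ-atoms : ∀ {e f a b} → e ≈ atom a → f ≈ atom b → e ⇒ᶜ f ≈ [ [ a ] , [ b ] ]
  ⇒ᶜ-atoms {e} {f} {a} {b} (e≼a , a≼e) (f≼b , b≼f) = to , from
    where
    to : e ⇒ᶜ f ≼ [ [ a ] , [ b ] ]
    to {w} p = each λ { (here refl) → Entails-mono
      (⊔-lub {w ⊔ ([ a ] , [])} {pos b} (⊔-mono {w} ⊑-refl (id , λ ())) (⊑-trans ((λ ()) , id) (⊑-⊔₂ {w})))
      (clause (f≼b (⇒ᶜ-elim e f (⊩-mono (⊑-⊔₁ {w}) p) (a≼e (⊩-hyp (∈-++⁺ʳ (proj₁ w) (here refl)))))) (here refl)) }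

    from : [ [ a ] , [ b ] ] ≼ e ⇒ᶜ f
    from p = ⇒ᶜ-intro e f λ {w} le q → b≼f (each λ { (here refl) →
      cut (w ⊔ pos b) a
        (Entails-mono (⊔-mono {w} {d = pos a} (⊑-⊔₁ {w}) ⊑-refl) (clause (e≼a q) (here refl)))
        (Entails-mono (⊑-trans (⊔-mono {d = [ a ] , [ b ]} le ⊑-refl)
          (⊑-trans (⊔-mono {w} {w} {[ a ] , [ b ]} {pos b ⊔ neg a} ⊑-refl (id , id)) (⊔-assocˡ w (pos b) (neg a))))
          (clause p (here refl))) })

  -- H is a sublattice of the extension, so the join of two of its elements is already its own box.
  I-∨ᶜ : ∀ {e f a b} → e ≈ atom a → f ≈ atom b → atom (I (e ∨ᶜ f)) ≈ atom (a ∨ᵢ b)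
  I-∨ᶜ {e} {f} {a} {b} (e≼a , a≼e) (f≼b , b≼f) = I-greatest (e ∨ᶜ f) to from
    where
    w : Clause
    w = [ a ∨ᵢ b ] , []

    to : w ⊩ e ∨ᶜ f
    to = ⊩-∨ᶜ-intro e f λ {c} ci → b≼f (each λ { (here refl) →
      cut (w ⊔ c ⊔ pos b) a
        ⟪ ∨E (hyp (here refl)) (⋁I (∈-++⁺ʳ (proj₂ c ++ [ b ]) (here refl)) h₀)
                               (⋁I (∈-++⁺ˡ (∈-++⁺ʳ (proj₂ c) (here refl))) h₀) ⟫
        (Entails-mono (⊔-lub {neg a} {c} (⊑-⊔₂ {w ⊔ c ⊔ pos b})
            (⊑-trans (⊑-⊔₂ {w}) (⊑-trans (⊑-⊔₁ {w ⊔ c}) (⊑-⊔₁ {w ⊔ c ⊔ pos b}))))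
          (clause (a≼e (⊩-hyp (here refl))) ci)) })

    from : ∀ {L} → L , [] ⊩ e ∨ᶜ f → L ⊢ a ∨ᵢ b
    from {L} r = ∨E (⊢-weaken (λ i → proj₁ (⊔-∅ (L , [])) (proj₁ (⊔-∅ (L ++ [] , [])) i)) (derivation b∨a))
      (∨I₂ h₀) (∨E h₀ (∨I₁ h₀) (⊥E h₀))
      where
      b∨a : Entails ((L , []) ⊔ pos b ⊔ pos a)
      b∨a = clause (e≼a (each λ {c} ci →
        Entails-mono (⊔-swap (L , []) c (pos b)) (clause (f≼b (⊩-∨ᶜ-elim e f r ci)) (here refl)))) (here refl)

  -- Monotonicity of `M` passes to the single clause, where only the units ⊤ and ⊥ of ⋀ and ⋁ remain
  -- to be removed.
  M-⇒ᶜ : ∀ {e f a b} → e ≈ atom a → f ≈ atom b → atom (M (e ⇒ᶜ f)) ≈ atom (a ⇝ b)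
  M-⇒ᶜ {a = a} {b} p q =
    (λ r → ⊩-⊢ [ _ ] (λ { (here refl) → r })
      (⇝-trans (⇝-thm (∧I h₀ ⊤I)) (⇝-trans (∧E₁ (M-mono (proj₁ (⇒ᶜ-atoms p q)))) (⇝-thm (∨E h₀ h₀ (⊥E h₀)))))) ,
    (λ r → ⊩-⊢ [ _ ] (λ { (here refl) → r })
      (⊢-trans (∧I (⇝-trans (⇝-thm (∧E₁ h₀)) (⇝-trans h₀ (⇝-thm (∨I₁ h₀)))) ⊤I)
        (M-mono (proj₂ (⇒ᶜ-atoms p q)))))

  -- The box fixes the elements of H. This yields axiom 4, BHL and the outer box in the translation
  -- of an arrow.
  I-atom : ∀ {a e} → e ≈ atom a → atom (I e) ≈ atom a
  I-atom {e = e} (p , q) = I-greatest e (q (⊩-hyp (here refl))) (λ r → ⊩⇒⊢ (p r))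

  -- Leaving `σ` free up to equivalence serves two uses: `I ∘ v` for the validity of t(Γ), and `var`
  -- for faithfulness.
  ⟦t⟧ : ∀ v σ → (∀ n → atom (I (v n)) ≈ atom (σ n)) → ∀ φ → ⟦ t φ ⟧ v ≈ atom (isub σ φ)
  ⟦t⟧ v σ v≈σ (var n) = v≈σ n
  ⟦t⟧ v σ v≈σ ⊤ᵢ = (λ _ → ⊩-⊢ [] (λ ()) ⊤I) , (λ _ → each λ ())
  ⟦t⟧ v σ v≈σ ⊥ᵢ =
    (λ {w} r → each λ _ → Entails-mono (⊔-mono {w} {d = ∅} ⊑-refl ((λ ()) , λ ())) (clause r (here refl))) ,
    (λ r → atom-elim r (each λ { (here refl) → ⟪ h₀ ⟫ }))
  ⟦t⟧ v σ v≈σ (a ∧ᵢ b) = I-greatest (⟦ t a ⟧ v ++ ⟦ t b ⟧ v)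
    (⊩-++ (⟦ t a ⟧ v) (proj₂ α (⊢⇒⊩ (∧E₁ h₀))) (proj₂ β (⊢⇒⊩ (∧E₂ h₀))))
    (λ r → ∧I (⊩⇒⊢ (proj₁ α (⊩-⊆ ∈-++⁺ˡ r))) (⊩⇒⊢ (proj₁ β (⊩-⊆ (∈-++⁺ʳ (⟦ t a ⟧ v)) r))))
    where
    α = ⟦t⟧ v σ v≈σ a
    β = ⟦t⟧ v σ v≈σ b
  ⟦t⟧ v σ v≈σ (a ∨ᵢ b) = I-∨ᶜ (⟦t⟧ v σ v≈σ a) (⟦t⟧ v σ v≈σ b)
  ⟦t⟧ v σ v≈σ (a ⇒ᵢ b) = I-greatest (⟦ t a ⟧ v ⇒ᶜ ⟦ t b ⟧ v)
    (proj₂ αβ (each λ { (here refl) → ⟪ ∨I₁ (⇒E h₀ h₁) ⟫ }))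
    (λ {L} r → ⇒I (∨E (⊢-weaken (λ i → [ there , (λ { (here refl) → here refl }) ]′ (∈-++⁻ L i))
      (derivation (clause (proj₁ αβ r) (here refl)))) h₀ (⊥E h₀)))
    where
    αβ = ⇒ᶜ-atoms (⟦t⟧ v σ v≈σ a) (⟦t⟧ v σ v≈σ b)
  ⟦t⟧ v σ v≈σ (a ⇝ b) = I-atom (M-⇒ᶜ (⟦t⟧ v σ v≈σ a) (⟦t⟧ v σ v≈σ b))

  -- Validity in the extension

  Valid : MForm → Set
  Valid φ = ∀ v → ∅ ⊩ ⟦ φ ⟧ v

  valid-⇒ : ∀ a b → (∀ v → ⟦ a ⟧ v ≼ ⟦ b ⟧ v) → Valid (a ⇒ₘ b)
  valid-⇒ a b p v = ⇒ᶜ-intro (⟦ a ⟧ v) (⟦ b ⟧ v) λ _ → p v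

  valid-K : ∀ (B : CNF → IForm) → (∀ e f → B (e ⇒ᶜ f) ∷ B e ∷ [] ⊢ B f) →
    ∀ e f → ∅ ⊩ atom (B (e ⇒ᶜ f)) ⇒ᶜ (atom (B e) ⇒ᶜ atom (B f))
  valid-K B B-K e f =
    ⇒ᶜ-intro (atom (B (e ⇒ᶜ f))) (atom (B e) ⇒ᶜ atom (B f)) λ _ p →
    ⇒ᶜ-intro (atom (B e)) (atom (B f)) λ le q →
    ⊩-⊢ (B (e ⇒ᶜ f) ∷ B e ∷ []) (λ { (here refl) → ⊩-mono le p ; (there (here refl)) → q }) (B-K e f)

  I-K : ∀ e f → I (e ⇒ᶜ f) ∷ I e ∷ [] ⊢ I f
  I-K e f = I-intro f (⇒ᶜ-elim e f (I-elim (e ⇒ᶜ f) h₀) (I-elim e h₁))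

  -- Concatenation is the meet of the two normal forms and lies below `f`, so monotonicity of `M`
  -- suffices.
  M-K : ∀ e f → M (e ⇒ᶜ f) ∷ M e ∷ [] ⊢ M f
  M-K e f = ⊢-trans (M-++ (e ⇒ᶜ f) e h₀ h₁) (M-mono λ p → ⇒ᶜ-elim e f (⊩-⊆ ∈-++⁺ˡ p) (⊩-⊆ (∈-++⁺ʳ (e ⇒ᶜ f)) p))

  valid : ∀ {φ} → S4K⊕ (tImg+Grz+BHL Γ) φ → Valid φ
  valid {φ} (g-taut τ) v = tautology (⟦ φ ⟧ v) λ w → trans (eval-⟦⟧ w v φ) (τ _ (boxValue v w))
  valid (g-Kᵢ a b) v = valid-K I I-K (⟦ a ⟧ v) (⟦ b ⟧ v)
  valid (g-Kₘ a b) v = valid-K M M-K (⟦ a ⟧ v) (⟦ b ⟧ v)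
  valid (g-Tᵢ a) = valid-⇒ (□ᵢ a) a λ v → I-≼ (⟦ a ⟧ v)
  valid (g-4ᵢ a) = valid-⇒ (□ᵢ a) (□ᵢ (□ᵢ a)) λ v → proj₂ (I-atom (id , id))
  valid (g-hyp (inj₁ (γ , i , refl))) v =
    -- Λ is closed under substitution, so the instance of `γ` that gives the value of `t γ` is a
    -- theorem.
    proj₂ (⟦t⟧ v (I ∘ v) (λ _ → id , id) γ) (⊢⇒⊩ (thm (i-usub (I ∘ v) (i-hyp i))))
  valid (g-hyp (inj₂ (inj₁ refl))) = valid-⇒ (□ᵢ (□ᵢ (p₀ ⇒ₘ □ᵢ p₀) ⇒ₘ p₀)) p₀ λ v → grz (v 0)
  valid (g-hyp (inj₂ (inj₂ refl))) = valid-⇒ (□ₘ p₀) (□ᵢ (□ₘ p₀)) λ v → proj₂ (I-atom (id , id))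
  valid (g-mp {φ} {ψ} p q) v = ⇒ᶜ-elim (⟦ φ ⟧ v) (⟦ ψ ⟧ v) (valid p v) (valid q v)
  valid (g-necᵢ {φ} p) v = ⊢⇒⊩ (I-intro (⟦ φ ⟧ v) (valid p v))
  -- The empty normal form is the top, and `M []` is ⊤, so monotonicity of `M` carries validity
  -- over.
  valid (g-necₘ {φ} p) v = ⊢⇒⊩ (⊢-subst (λ { (here refl) → ⊤I })
    (M-mono {[]} λ _ → ⊩-mono ((λ ()) , λ ()) (valid p v)))
  valid (g-usub {φ} σ p) v = subst (∅ ⊩_) (sym (⟦msub⟧ σ φ v)) (valid p (λ n → ⟦ σ n ⟧ v))

  isub-var : ∀ φ → isub var φ ≡ φ
  isub-var (var n)  = refl
  isub-var ⊤ᵢ       = refl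
  isub-var ⊥ᵢ       = refl
  isub-var (a ∧ᵢ b) = cong₂ _∧ᵢ_ (isub-var a) (isub-var b)
  isub-var (a ∨ᵢ b) = cong₂ _∨ᵢ_ (isub-var a) (isub-var b)
  isub-var (a ⇒ᵢ b) = cong₂ _⇒ᵢ_ (isub-var a) (isub-var b)
  isub-var (a ⇝ b)  = cong₂ _⇝_ (isub-var a) (isub-var b)

  -- Under the canonical valuation by variables, `t φ` takes the class of `φ` itself as its value,
  -- and being the top there means being a theorem of Λ.
  t-faithful : ∀ φ → S4K⊕ (tImg+Grz+BHL Γ) (t φ) → IA⊕ Γ φ
  t-faithful φ p = theorem (⊩⇒⊢ (subst (λ ψ → ∅ ⊩ atom ψ) (isub-var φ)
    (proj₁ (⟦t⟧ (atom ∘ var) var (λ _ → I-atom (id , id)) φ) (valid p (atom ∘ var)))))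

theorem4p16 : (Γ : IForm → Set) (Θ : MForm → Set) → IsS4KLogic Θ →
    (∀ φ → S4K⊕ (tImg Γ) φ → Θ φ) →
    (∀ φ → Θ φ → S4K⊕ (tImg+Grz+BHL Γ) φ) →
    ∀ φ → ((IA⊕ Γ φ → Θ (t φ)) × (Θ (t φ) → IA⊕ Γ φ))
theorem4p16 Γ Θ logic lower upper φ =
  Soundness.t-sound Θ logic (λ {γ} i → lower (t γ) (g-hyp (γ , i , refl))) ,
  (λ p → BooleanExtension.t-faithful Γ φ (upper (t φ) p))
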